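{- Let $A\in\mathbb{R}^{m\times n}$ have full rank $m\le n$, let $D\in\mathbb{R}^{n\times n}$ be a diagonal matrix with positive diagonal entries, let $p\in\mathbb{R}^m$, let $\zeta\in[0,1]$, and let $Q\in\mathbb{R}^{m\times m}$ be a symmetric positive definite matrix such that $$\frac{2}{2+\zeta}\le\sigma_{\min}^2(Q^{ -1/2}AD)\le\sigma_{\max}^2(Q^{ -1/2}AD)\le\frac{2}{2-\zeta}.$$ Let $\tilde z^t$ be the approximate solution returned after $t$ iterations of Chebyshev iteration, with spectral interval $[\frac{2}{2+\zeta},\frac{2}{2-\zeta}]$ and started at $\tilde z^0=0$, applied to $Q^{ -1/2}AD^2A^{\top}Q^{ -1/2}z=Q^{ -1/2}p$. Then for every $t\ge0$ $$\|Q^{ -1/2}AD^2A^{\top}Q^{ -1/2}\tilde z^t-Q^{ -1/2}p\|_2\le\zeta^t\,\|Q^{ -1/2}p\|_2 .$$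
   Context: $\sigma_{\min}(\cdot)$ and $\sigma_{\max}(\cdot)$ denote the smallest and largest singular values (of an $m\times n$ matrix, the $m$-th and the first). Convention: $\zeta^0=1$. Chebyshev iteration with spectral interval $[a,b]$, $0<a<b$, for a symmetric positive definite system $Mz=q$, started at $z^0=0$, produces the iterates $z^t$ whose residuals are $Mz^t-q=-P_t(M)q$, where $P_t(\lambda)=T_t\big(\tfrac{b+a-2\lambda}{b-a}\big)/T_t\big(\tfrac{b+a}{b-a}\big)$ and $T_t$ is the Chebyshev polynomial of the first kind of degree $t$. In the degenerate case $a=b$ take $P_t(\lambda)=(1-\lambda/a)^t$. -}

module Defs where

open import Level using (Level; _⊔_) renaming (suc to lsuc)
open import Algebra.Core using (Op₁)
open import Algebra.Bundles using (CommutativeRing)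
open import Algebra.Bundles.Raw using (RawRing)
open import Algebra.Apartness.Bundles using (HeytingField; HeytingCommutativeRing)
import Algebra.Apartness.Properties.HeytingCommutativeRing as HeytingProperties
import Algebra.Definitions.RawSemiring as RawSemiringDefinitions
import Algebra.Properties.Ring as RingProperties
open import Data.Bool.Base using (if_then_else_)
open import Data.Empty using (⊥-elim)
open import Data.Fin.Base as Fin using (Fin; inject≤)
import Data.Fin.Properties as Fin
open import Data.Nat.Base as ℕ using (ℕ; zero; suc; NonZero)
open import Data.Product.Base using (∃; _×_; _,_; proj₁; proj₂)
open import Data.Sum.Base using (_⊎_; inj₁; inj₂; [_,_]′)
open import Data.Vec.Functional using (Vector; zipWith; map; transpose)
open import Relation.Binary.Core using (Rel)
open import Relation.Binary.PropositionalEquality.Core using (_≢_)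
open import Relation.Binary.Structures using (IsStrictPartialOrder)
import Relation.Binary.Reasoning.Setoid as SetoidReasoning
open import Relation.Nullary.Decidable.Core using (does)
open import Relation.Nullary.Negation.Core using (¬_)

-- The real numbers, up to isomorphism: an Archimedean, Cauchy complete ordered
-- field.  Classically this is the complete ordered field; the axioms are
-- phrased so that constructive (e.g. regular Cauchy) reals satisfy them too.
record RealNumbers c ℓ₁ ℓ₂ : Set (lsuc (c ⊔ ℓ₁ ⊔ ℓ₂)) where
  infix  4 _<_ _≤_
  infixl 7 _/_⟨_⟩
  field
    heytingField : HeytingField c ℓ₁ ℓ₂

  open HeytingField heytingField public

  commutativeRing : CommutativeRing c ℓ₁
  commutativeRing = HeytingCommutativeRing.commutativeRing heytingCommutativeRing

  open CommutativeRing commutativeRing public using (ring; rawRing)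
  open RawSemiringDefinitions (RawRing.rawSemiring rawRing) public
    using (_^_; sum) renaming (_×_ to _×ℕ_)

  field
    _<_                  : Rel Carrier ℓ₂
    isStrictPartialOrder : IsStrictPartialOrder _≈_ _<_
    <⇒#                  : ∀ {x y} → x < y → x # y
    #⇒<⊎>                : ∀ {x y} → x # y → x < y ⊎ y < x
    +-monoʳ-<            : ∀ x {y z} → y < z → x + y < x + z
    *-pos                : ∀ {x y} → 0# < x → 0# < y → 0# < x * y

  _≤_ : Rel Carrier ℓ₂
  x ≤ y = ¬ (y < x)

  -- ∣x∣ < ε
  Small : Carrier → Carrier → Set ℓ₂
  Small ε x = - ε < x × x < ε

  IsCauchy : (ℕ → Carrier) → Set (c ⊔ ℓ₂)
  IsCauchy s = ∀ ε → 0# < ε → ∃ λ N → ∀ i j → N ℕ.≤ i → N ℕ.≤ j → Small ε (s i - s j)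

  _ConvergesTo_ : (ℕ → Carrier) → Carrier → Set (c ⊔ ℓ₂)
  s ConvergesTo l = ∀ ε → 0# < ε → ∃ λ N → ∀ i → N ℕ.≤ i → Small ε (s i - l)

  field
    archimedean : ∀ x → ∃ λ n → x < n ×ℕ 1#
    complete    : ∀ s → IsCauchy s → ∃ λ l → s ConvergesTo l

  -- Square roots exist by completeness; they are included so that norms are
  -- functions.  The value of √ x for negative x is irrelevant.
  field
    √_       : Op₁ Carrier
    √-nonneg : ∀ x → 0# ≤ √ x
    √-square : ∀ x → 0# ≤ x → √ x * √ x ≈ x

  open IsStrictPartialOrder isStrictPartialOrder public
    using () renaming (irrefl to <-irrefl; trans to <-trans; asym to <-asym;
                       <-respˡ-≈ to <-respˡ-≈; <-respʳ-≈ to <-respʳ-≈)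

  0<⇒#0 : ∀ {x} → 0# < x → x # 0#
  0<⇒#0 0<x = #-sym (<⇒# 0<x)

  -- The library states invertibility for x - y with x # y; here y is 0#.
  inverse : ∀ x → x # 0# → Carrier
  inverse x x#0 = proj₁ (#⇒invertible x#0)

  _/_⟨_⟩ : Carrier → (y : Carrier) → 0# < y → Carrier
  x / y ⟨ 0<y ⟩ = x * inverse y (0<⇒#0 0<y)

  2# : Carrier
  2# = 1# + 1#

module OrderLemmas {c ℓ₁ ℓ₂} (ℝ : RealNumbers c ℓ₁ ℓ₂) where
  open RealNumbers ℝ
  open HeytingProperties heytingCommutativeRing using (1#0; x-0≈x)
  open RingProperties ring
    using (-‿distribˡ-*; -‿distribʳ-*; -‿involutive; -0#≈0#)

  <-cotrans : ∀ {x y} z → x < y → x < z ⊎ z < y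
  <-cotrans z x<y with #-cotrans (<⇒# x<y) z
  ... | inj₁ x#z = [ inj₁ , (λ z<x → inj₂ (<-trans z<x x<y)) ]′ (#⇒<⊎> x#z)
  ... | inj₂ z#y = [ inj₂ , (λ y<z → inj₁ (<-trans x<y y<z)) ]′ (#⇒<⊎> z#y)

  ≤-<-trans : ∀ {x y z} → x ≤ y → y < z → x < z
  ≤-<-trans {x} x≤y y<z = [ (λ y<x → ⊥-elim (x≤y y<x)) , (λ x<z → x<z) ]′ (<-cotrans x y<z)

  <-≤-trans : ∀ {x y z} → x < y → y ≤ z → x < z
  <-≤-trans {z = z} x<y y≤z = [ (λ x<z → x<z) , (λ z<y → ⊥-elim (y≤z z<y)) ]′ (<-cotrans z x<y)

  +-monoˡ-< : ∀ x {y z} → y < z → y + x < z + x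
  +-monoˡ-< x y<z = <-respˡ-≈ (+-comm _ _) (<-respʳ-≈ (+-comm _ _) (+-monoʳ-< x y<z))

  x<y⇒0<y-x : ∀ {x y} → x < y → 0# < y - x
  x<y⇒0<y-x {x} x<y = <-respˡ-≈ (-‿inverseʳ x) (+-monoˡ-< (- x) x<y)

  0<y-x⇒x<y : ∀ {x y} → 0# < y - x → x < y
  0<y-x⇒x<y {x} {y} 0<d =
    <-respˡ-≈ (+-identityˡ x)
      (<-respʳ-≈ (trans (+-assoc y (- x) x) (trans (+-congˡ (-‿inverseˡ x)) (+-identityʳ y)))
        (+-monoˡ-< x 0<d))

  +-pos : ∀ {x y} → 0# < x → 0# < y → 0# < x + y
  +-pos {x} 0<x 0<y = <-trans 0<x (<-respˡ-≈ (+-identityʳ x) (+-monoʳ-< x 0<y))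

  0<1 : 0# < 1#
  0<1 with #⇒<⊎> 1#0
  ... | inj₂ 0<1′ = 0<1′
  ... | inj₁ 1<0  = ⊥-elim (<-asym 1<0 (<-respʳ-≈ square (*-pos 0<-1 0<-1)))
    where
    0<-1 : 0# < - 1#
    0<-1 = <-respʳ-≈ (+-identityˡ (- 1#)) (x<y⇒0<y-x 1<0)
    square : - 1# * - 1# ≈ 1#
    square = trans (sym (-‿distribˡ-* 1# (- 1#)))
      (trans (-‿cong (*-identityˡ (- 1#))) (-‿involutive 1#))

  0<2 : 0# < 2#
  0<2 = +-pos 0<1 0<1

  0<2+ : ∀ {x} → 0# ≤ x → 0# < 2# + x
  0<2+ {x} 0≤x = <-respʳ-≈ (+-comm x 2#)
    (≤-<-trans 0≤x (<-respˡ-≈ (+-identityʳ x) (+-monoʳ-< x 0<2)))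

  0<2- : ∀ {x} → x ≤ 1# → 0# < 2# - x
  0<2- x≤1 = x<y⇒0<y-x
    (≤-<-trans x≤1 (<-respˡ-≈ (+-identityʳ 1#) (+-monoʳ-< 1# 0<1)))

  inverseˡ : ∀ x (x#0 : x # 0#) → inverse x x#0 * x ≈ 1#
  inverseˡ x x#0 = trans (*-congˡ (sym (x-0≈x x))) (proj₁ (proj₂ (#⇒invertible x#0)))

  inverse-pos : ∀ x (x#0 : x # 0#) → 0# < x → 0# < inverse x x#0
  inverse-pos x x#0 0<x with #⇒<⊎> inv#0
    where
    open HeytingProperties heytingCommutativeRing using (invertibleˡ⇒#)
    inv#0 : inverse x x#0 # 0#
    inv#0 = invertibleˡ⇒# (x , trans (*-congˡ (x-0≈x _)) (trans (*-comm _ _) (inverseˡ x x#0)))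
  ... | inj₂ 0<i = 0<i
  ... | inj₁ i<0 = ⊥-elim (<-asym 0<1 1<0)
    where
    i = inverse x x#0
    0<-i : 0# < - i
    0<-i = <-respʳ-≈ (+-identityˡ (- i)) (x<y⇒0<y-x i<0)
    0<-1 : 0# < 0# - 1#
    0<-1 = <-respʳ-≈
      (trans (sym (-‿distribˡ-* i x)) (trans (-‿cong (inverseˡ x x#0)) (sym (+-identityˡ _))))
      (*-pos 0<-i 0<x)
    1<0 : 1# < 0#
    1<0 = 0<y-x⇒x<y 0<-1

  /-pos : ∀ {x y} → 0# < x → (0<y : 0# < y) → 0# < x / y ⟨ 0<y ⟩
  /-pos 0<x 0<y = *-pos 0<x (inverse-pos _ _ 0<y)

module LinearAlgebra {c ℓ₁ ℓ₂} (ℝ : RealNumbers c ℓ₁ ℓ₂) where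
  open RealNumbers ℝ

  infix  4 _≈ᵛ_ _≈ᴹ_
  infixl 6 _-ᵛ_ _+ᴹ_ _-ᴹ_
  infixl 7 _∙_ _*ᴹ_
  infixr 7 _*ᵛ_ _·ᴹ_
  infix  8 -ᵛ_ -ᴹ_

  ℝ^ : ℕ → Set c
  ℝ^ n = Vector Carrier n

  Matrix : ℕ → ℕ → Set c
  Matrix m n = Vector (Vector Carrier n) m

  private variable
    k m n : ℕ

  _≈ᵛ_ : Rel (ℝ^ n) ℓ₁
  u ≈ᵛ v = ∀ i → u i ≈ v i

  _≈ᴹ_ : Rel (Matrix m n) ℓ₁
  A ≈ᴹ B = ∀ i j → A i j ≈ B i j

  0ᵛ : ℝ^ n
  0ᵛ _ = 0#

  -ᵛ_ : ℝ^ n → ℝ^ n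
  -ᵛ_ = map (-_)

  _-ᵛ_ : ℝ^ n → ℝ^ n → ℝ^ n
  _-ᵛ_ = zipWith _-_

  _∙_ : ℝ^ n → ℝ^ n → Carrier
  u ∙ v = sum (λ i → u i * v i)

  ∥_∥₂ : ℝ^ n → Carrier
  ∥ v ∥₂ = √ (v ∙ v)

  _*ᵛ_ : Matrix m n → ℝ^ n → ℝ^ m
  (A *ᵛ v) i = A i ∙ v

  _ᵀ : Matrix m n → Matrix n m
  _ᵀ = transpose

  _+ᴹ_ _-ᴹ_ : Matrix m n → Matrix m n → Matrix m n
  _+ᴹ_ = zipWith (zipWith _+_)
  _-ᴹ_ = zipWith (zipWith _-_)

  -ᴹ_ : Matrix m n → Matrix m n
  -ᴹ_ = map (map (-_))

  _·ᴹ_ : Carrier → Matrix m n → Matrix m n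
  x ·ᴹ A = map (map (x *_)) A

  _*ᴹ_ : Matrix m k → Matrix k n → Matrix m n
  (A *ᴹ B) i j = sum (λ l → A i l * B l j)

  0ᴹ : Matrix m n
  0ᴹ _ _ = 0#

  1ᴹ : Matrix n n
  1ᴹ i j = if does (i Fin.≟ j) then 1# else 0#

  matrixRawRing : ℕ → RawRing c ℓ₁
  matrixRawRing n = record
    { Carrier = Matrix n n
    ; _≈_     = _≈ᴹ_
    ; _+_     = _+ᴹ_
    ; _*_     = _*ᴹ_
    ; -_      = -ᴹ_
    ; 0#      = 0ᴹ
    ; 1#      = 1ᴹ
    }

  _^ᴹ_ : Matrix n n → ℕ → Matrix n n
  _^ᴹ_ {n} = RawSemiringDefinitions._^_ (RawRing.rawSemiring (matrixRawRing n))

  IsDiagonal : Matrix n n → Set ℓ₁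
  IsDiagonal D = ∀ i j → i ≢ j → D i j ≈ 0#

  -- rank A = r : the column space of A has a basis of r vectors, given here as
  -- the columns of a matrix.
  record HasRank {m n} (A : Matrix m n) (r : ℕ) : Set (c ⊔ ℓ₁) where
    field
      basis         : Matrix m r
      independent   : ∀ x → basis *ᵛ x ≈ᵛ 0ᵛ → x ≈ᵛ 0ᵛ
      inColumnSpace : ∀ j → ∃ λ x → A *ᵛ x ≈ᵛ (basis ᵀ) j
      spanning      : ∀ j → ∃ λ x → basis *ᵛ x ≈ᵛ (A ᵀ) j

  record IsSymmetricPositiveDefinite {n} (Q : Matrix n n) : Set (c ⊔ ℓ₁ ⊔ ℓ₂) where
    field
      symmetric        : Q ᵀ ≈ᴹ Q
      positiveDefinite : ∀ x → ∃ (λ i → x i # 0#) → 0# < x ∙ (Q *ᵛ x)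

  -- R = Q^{-1/2}
  record IsInverseSquareRoot {n} (R Q : Matrix n n) : Set (c ⊔ ℓ₁ ⊔ ℓ₂) where
    field
      isSymmetricPositiveDefinite : IsSymmetricPositiveDefinite R
      inverseˡ                    : (R *ᴹ R) *ᴹ Q ≈ᴹ 1ᴹ
      inverseʳ                    : Q *ᴹ (R *ᴹ R) ≈ᴹ 1ᴹ

  record IsOrthogonal {n} (U : Matrix n n) : Set ℓ₁ where
    field
      orthogonalˡ : U ᵀ *ᴹ U ≈ᴹ 1ᴹ
      orthogonalʳ : U *ᴹ U ᵀ ≈ᴹ 1ᴹ

  rectangularDiagonal : m ℕ.≤ n → ℝ^ m → Matrix m n
  rectangularDiagonal m≤n σ i j = if does (inject≤ i m≤n Fin.≟ j) then σ i else 0#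

  -- σ₁ ≥ … ≥ σₘ ≥ 0 are the singular values of B, with multiplicity: the
  -- diagonal in a singular value decomposition B = U Σ Vᵀ.
  record AreSingularValues {m n} (m≤n : m ℕ.≤ n) (B : Matrix m n) (σ : ℝ^ m)
         : Set (c ⊔ ℓ₁ ⊔ ℓ₂) where
    field
      nonneg       : ∀ i → 0# ≤ σ i
      descending   : ∀ i j → i Fin.≤ j → σ j ≤ σ i
      U            : Matrix m m
      V            : Matrix n n
      U-orthogonal : IsOrthogonal U
      V-orthogonal : IsOrthogonal V
      factorises   : B ≈ᴹ U *ᴹ rectangularDiagonal m≤n σ *ᴹ V ᵀ

  first last : .{{_ : NonZero m}} → ℝ^ m → Carrier
  first {suc m} σ = σ Fin.zero
  last  {suc m} σ = σ (Fin.fromℕ m)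

-- T 0 x = 1, T 1 x = x, T (t + 2) x = 2 x T (t + 1) x - T t x, in any ring.
module ChebyshevPolynomial {c ℓ} (R : RawRing c ℓ) where
  open RawRing R

  T : ℕ → Carrier → Carrier
  T 0             x = 1#
  T 1             x = x
  T (suc (suc t)) x = (1# + 1#) * x * T (suc t) x + - T t x

module ChebyshevIteration {c ℓ₁ ℓ₂} (ℝ : RealNumbers c ℓ₁ ℓ₂) where
  open RealNumbers ℝ
  open OrderLemmas ℝ
  open LinearAlgebra ℝ
  open ChebyshevPolynomial rawRing using (T)
  open RingProperties ring using (-‿distribˡ-*; -‿involutive; -‿+-comm)

  -- 0 < T t x < T (t + 1) x for x > 1
  T-pos-increasing : ∀ {x} → 1# < x → ∀ t → 0# < T t x × T t x < T (suc t) x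
  T-pos-increasing 1<x zero = 0<1 , 1<x
  T-pos-increasing {x} 1<x (suc t) = 0<T₁ , 0<y-x⇒x<y (<-respʳ-≈ (sym split) 0<parts)
    where
    open SetoidReasoning setoid
    T₀ = T t x
    T₁ = T (suc t) x
    ih = T-pos-increasing 1<x t
    0<T₁ : 0# < T₁
    0<T₁ = <-trans (proj₁ ih) (proj₂ ih)
    0<parts : 0# < 2# * ((x - 1#) * T₁) + (T₁ - T₀)
    0<parts = +-pos (*-pos 0<2 (*-pos (x<y⇒0<y-x 1<x) 0<T₁)) (x<y⇒0<y-x (proj₂ ih))
    twice : ∀ y → 2# * y ≈ y + y
    twice y = trans (distribʳ y 1# 1#) (+-cong (*-identityˡ y) (*-identityˡ y))
    e : Carrier
    e = (x - 1#) * T₁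
    e≈ : x * T₁ ≈ e + T₁
    e≈ = begin
      x * T₁                    ≈⟨ *-congʳ (sym (trans (+-assoc x (- 1#) 1#)
                                     (trans (+-congˡ (-‿inverseˡ 1#)) (+-identityʳ x)))) ⟩
      (x - 1# + 1#) * T₁        ≈⟨ distribʳ T₁ (x - 1#) 1# ⟩
      e + 1# * T₁               ≈⟨ +-congˡ (*-identityˡ T₁) ⟩
      e + T₁                    ∎
    split : T (suc (suc t)) x - T₁ ≈ 2# * e + (T₁ - T₀)
    split = begin
      2# * x * T₁ - T₀ - T₁             ≈⟨ +-congʳ (+-congʳ (trans (*-assoc 2# x T₁) (*-congˡ e≈))) ⟩
      2# * (e + T₁) - T₀ - T₁           ≈⟨ +-congʳ (+-congʳ (trans (distribˡ 2# e T₁) (+-congˡ (twice T₁)))) ⟩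
      2# * e + (T₁ + T₁) - T₀ - T₁      ≈⟨ +-assoc _ (- T₀) (- T₁) ⟩
      2# * e + (T₁ + T₁) + (- T₀ - T₁)  ≈⟨ +-assoc (2# * e) (T₁ + T₁) _ ⟩
      2# * e + (T₁ + T₁ + (- T₀ - T₁))  ≈⟨ +-congˡ (+-congˡ (+-comm (- T₀) (- T₁))) ⟩
      2# * e + (T₁ + T₁ + (- T₁ - T₀))  ≈⟨ +-congˡ (sym (+-assoc (T₁ + T₁) (- T₁) (- T₀))) ⟩
      2# * e + (T₁ + T₁ - T₁ - T₀)      ≈⟨ +-congˡ (+-congʳ (trans (+-assoc T₁ T₁ (- T₁))
                                             (trans (+-congˡ (-‿inverseʳ T₁)) (+-identityʳ T₁)))) ⟩
      2# * e + (T₁ - T₀)                ∎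

  T-pos : ∀ {x} → 1# < x → ∀ t → 0# < T t x
  T-pos 1<x t = proj₁ (T-pos-increasing 1<x t)

  module _ {a b : Carrier} (0<a : 0# < a) (a<b : a < b) where

    0<b-a : 0# < b - a
    0<b-a = x<y⇒0<y-x a<b

    θ : Carrier
    θ = (b + a) / (b - a) ⟨ 0<b-a ⟩

    1<θ : 1# < θ
    1<θ = 0<y-x⇒x<y (<-respʳ-≈ eq (*-pos 0<2a (inverse-pos (b - a) (0<⇒#0 0<b-a) 0<b-a)))
      where
      open SetoidReasoning setoid
      i = inverse (b - a) (0<⇒#0 0<b-a)
      0<2a : 0# < b + a - (b - a)
      0<2a = x<y⇒0<y-x (+-monoʳ-< b (<-trans (0<y-x⇒x<y (<-respʳ-≈
        (sym (trans (+-identityˡ _) (-‿involutive a))) 0<a)) 0<a))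
      eq : (b + a - (b - a)) * i ≈ θ - 1#
      eq = begin
        (b + a - (b - a)) * i            ≈⟨ distribʳ i (b + a) (- (b - a)) ⟩
        θ + - (b - a) * i                ≈⟨ +-congˡ (sym (-‿distribˡ-* (b - a) i)) ⟩
        θ - (b - a) * i                  ≈⟨ +-congˡ (-‿cong (trans (*-comm (b - a) i)
                                              (inverseˡ (b - a) (0<⇒#0 0<b-a)))) ⟩
        θ - 1#                           ∎

    -- P_t(M) = T_t((b + a - 2 M) / (b - a)) / T_t((b + a) / (b - a)), with the
    -- numerator evaluated in the ring of matrices.
    P : ∀ {m} → ℕ → Matrix m m → Matrix m m
    P {m} t M = (1# / T t θ ⟨ T-pos 1<θ t ⟩) ·ᴹ Tᴹ t
      ((1# / (b - a) ⟨ 0<b-a ⟩) ·ᴹ ((b + a) ·ᴹ 1ᴹ -ᴹ 2# ·ᴹ M))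
      where open ChebyshevPolynomial (matrixRawRing m) renaming (T to Tᴹ)

  -- P_t(M) = (1 - M / a)^t
  degenerateP : ∀ {a} → 0# < a → ∀ {m} → ℕ → Matrix m m → Matrix m m
  degenerateP {a} 0<a t M = (1ᴹ -ᴹ (1# / a ⟨ 0<a ⟩) ·ᴹ M) ^ᴹ t

  -- z is the sequence of iterates of Chebyshev iteration for M z = q with
  -- spectral interval [a , b], started at 0.
  record AreChebyshevIterates {m} {a : Carrier} (0<a : 0# < a) (b : Carrier)
         (M : Matrix m m) (q : ℝ^ m) (z : ℕ → ℝ^ m) : Set (c ⊔ ℓ₁ ⊔ ℓ₂) where
    field
      start              : z 0 ≈ᵛ 0ᵛ
      residual           : (a<b : a < b) → ∀ t →
                           M *ᵛ z t -ᵛ q ≈ᵛ -ᵛ (P 0<a a<b t M *ᵛ q)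
      degenerateResidual : a ≈ b → ∀ t →
                           M *ᵛ z t -ᵛ q ≈ᵛ -ᵛ (degenerateP 0<a t M *ᵛ q)

{-# OPTIONS --safe #-}

-- Write B = Q^{-1/2} A D = U Σ Vᵀ.  Then M = B Bᵀ, so Uᵀ diagonalises M with
-- eigenvalues σᵢ² ∈ [a , b], and the residual -P_t(M) q has coordinates
-- -P_t(σᵢ²) (Uᵀ q)ᵢ in the orthonormal basis U.  It remains to bound the scalars
-- P_t(σᵢ²) by ζ^t.  On [-1 , 1] one has T_t² ≤ 1 by the Pell equation
-- T_t² + (1 - x²) U_{t-1}² = 1; and (b + a) / (b - a) = 2 / ζ, where the recurrence
-- reads ζ T_{t+1} = 4 T_t - ζ T_{t-1} ≥ T_t, so that ζ^t T_t ≥ 1.  The cases ζ > 0 and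
-- ζ = 0 (where a = b) may be distinguished because the goal is a negation.
module Submission where

open import Defs
open import Algebra.Bundles using (CommutativeRing)
import Algebra.Properties.CommutativeSemigroup as CommutativeSemigroupProperties
import Algebra.Properties.Ring as RingProperties
import Algebra.Properties.Semiring.Exp as Exponentiation
import Algebra.Properties.Semiring.Mult.TCOptimised as SemiringMultiplication
import Algebra.Properties.Semiring.Sum as SumProperties
import Algebra.Solver.Ring as RingSolver
open import Algebra.Solver.Ring.AlmostCommutativeRing
  using (fromCommutativeRing; _-Raw-AlmostCommutative⟶_)
open import Data.Bool.Base using (if_then_else_)
open import Data.Fin.Base as Fin using (Fin; inject≤)
import Data.Fin.Properties as Fin
open import Data.Integer.Base as ℤ using (ℤ; +_; -[1+_])
import Data.Integer.Properties as ℤ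
open import Data.Maybe.Base as Maybe using (Maybe)
open import Data.Nat.Base as ℕ using (ℕ; zero; suc; NonZero) renaming (_≤_ to _≤ℕ_)
import Data.Nat.Properties as ℕ
open import Data.Product.Base using (∃; _×_; _,_; proj₁; proj₂)
open import Data.Sum.Base using (_⊎_; inj₁; inj₂; [_,_]′)
open import Function.Bundles using (mk⇔)
open import Relation.Binary.PropositionalEquality.Core as ≡ using (_≡_)
import Relation.Binary.Reasoning.Setoid as SetoidReasoning
open import Relation.Nullary.Decidable.Core using (does; yes; no; dec⇒maybe)
open import Relation.Nullary.Decidable using (does-⇔)
open import Relation.Nullary.Negation.Core using (¬_)

-- The ring solver with integer coefficients, over any commutative ring.

module IntegerCoefficients {c ℓ} (R : CommutativeRing c ℓ) where
  open CommutativeRing R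
  open SemiringMultiplication semiring using (×-homo-+; ×1-homo-*) renaming (_×_ to _×ℕ_)
  open RingProperties ring using (-‿distribˡ-*; -‿distribʳ-*; -‿involutive; -‿+-comm; -0#≈0#)
  open CommutativeSemigroupProperties +-commutativeSemigroup using (interchange)
  open SetoidReasoning setoid

  private
    -- With the TCOptimised multiple, ⟦ + 0 ⟧, ⟦ + 1 ⟧ and ⟦ + 2 ⟧ reduce to 0#, 1# and
    -- 1# + 1#, so the solver matches these constants in goals definitionally.
    ⟦_⟧ : ℤ → Carrier
    ⟦ + n ⟧      = n ×ℕ 1#
    ⟦ -[1+ n ] ⟧ = - (suc n ×ℕ 1#)

    ⟦⊖⟧ : ∀ m n → ⟦ m ℤ.⊖ n ⟧ ≈ m ×ℕ 1# - n ×ℕ 1#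
    ⟦⊖⟧ m zero = sym (trans (+-congˡ -0#≈0#) (+-identityʳ _))
    ⟦⊖⟧ zero (suc n) = sym (+-identityˡ _)
    ⟦⊖⟧ (suc m) (suc n) = begin
      ⟦ suc m ℤ.⊖ suc n ⟧                    ≡⟨ ≡.cong ⟦_⟧ (ℤ.[1+m]⊖[1+n]≡m⊖n m n) ⟩
      ⟦ m ℤ.⊖ n ⟧                            ≈⟨ ⟦⊖⟧ m n ⟩
      m ×ℕ 1# - n ×ℕ 1#                      ≈⟨ +-identityˡ _ ⟨
      -- A zero written as `1# - 1#` supplies the unit that each multiple is short of.
      0# + (m ×ℕ 1# - n ×ℕ 1#)               ≈⟨ +-congʳ (-‿inverseʳ 1#) ⟨
      (1# - 1#) + (m ×ℕ 1# - n ×ℕ 1#)        ≈⟨ interchange 1# (- 1#) _ _ ⟩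
      (1# + m ×ℕ 1#) + (- 1# - n ×ℕ 1#)      ≈⟨ +-congˡ (-‿+-comm 1# _) ⟩
      (1# + m ×ℕ 1#) - (1# + n ×ℕ 1#)        ≈⟨ +-cong (×-homo-+ 1# 1 m) (-‿cong (×-homo-+ 1# 1 n)) ⟨
      suc m ×ℕ 1# - suc n ×ℕ 1#              ∎

    ⟦-⟧ : ∀ i → ⟦ ℤ.- i ⟧ ≈ - ⟦ i ⟧
    ⟦-⟧ (+ zero)  = sym -0#≈0#
    ⟦-⟧ (+ suc n) = refl
    ⟦-⟧ -[1+ n ]  = sym (-‿involutive _)

    ⟦+⟧ : ∀ i j → ⟦ i ℤ.+ j ⟧ ≈ ⟦ i ⟧ + ⟦ j ⟧
    ⟦+⟧ (+ m)    (+ n)    = ×-homo-+ 1# m n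
    ⟦+⟧ (+ m)    -[1+ n ] = ⟦⊖⟧ m (suc n)
    ⟦+⟧ -[1+ m ] (+ n)    = trans (⟦⊖⟧ n (suc m)) (+-comm _ _)
    ⟦+⟧ -[1+ m ] -[1+ n ] = begin
      - (suc (suc (m ℕ.+ n)) ×ℕ 1#)          ≡⟨ ≡.cong (λ k → - (k ×ℕ 1#)) (ℕ.+-suc (suc m) n) ⟨
      - ((suc m ℕ.+ suc n) ×ℕ 1#)            ≈⟨ -‿cong (×-homo-+ 1# (suc m) (suc n)) ⟩
      - (suc m ×ℕ 1# + suc n ×ℕ 1#)          ≈⟨ -‿+-comm _ _ ⟨
      - (suc m ×ℕ 1#) - suc n ×ℕ 1#          ∎

    ⟦+*⟧ : ∀ m j → ⟦ + m ℤ.* j ⟧ ≈ ⟦ + m ⟧ * ⟦ j ⟧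
    ⟦+*⟧ m (+ n)    = trans (reflexive (≡.cong ⟦_⟧ (≡.sym (ℤ.pos-* m n)))) (×1-homo-* m n)
    ⟦+*⟧ m -[1+ n ] = begin
      ⟦ + m ℤ.* -[1+ n ] ⟧                   ≡⟨ ≡.cong ⟦_⟧ (ℤ.neg-distribʳ-* (+ m) (+ suc n)) ⟨
      ⟦ ℤ.- (+ m ℤ.* + suc n) ⟧              ≈⟨ ⟦-⟧ (+ m ℤ.* + suc n) ⟩
      - ⟦ + m ℤ.* + suc n ⟧                  ≈⟨ -‿cong (⟦+*⟧ m (+ suc n)) ⟩
      - (⟦ + m ⟧ * ⟦ + suc n ⟧)              ≈⟨ -‿distribʳ-* _ _ ⟩
      ⟦ + m ⟧ * ⟦ -[1+ n ] ⟧                 ∎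

    ⟦*⟧ : ∀ i j → ⟦ i ℤ.* j ⟧ ≈ ⟦ i ⟧ * ⟦ j ⟧
    ⟦*⟧ (+ m)    j = ⟦+*⟧ m j
    ⟦*⟧ -[1+ m ] j = begin
      ⟦ -[1+ m ] ℤ.* j ⟧                     ≡⟨ ≡.cong ⟦_⟧ (ℤ.neg-distribˡ-* (+ suc m) j) ⟨
      ⟦ ℤ.- (+ suc m ℤ.* j) ⟧                ≈⟨ ⟦-⟧ (+ suc m ℤ.* j) ⟩
      - ⟦ + suc m ℤ.* j ⟧                    ≈⟨ -‿cong (⟦+*⟧ (suc m) j) ⟩
      - (⟦ + suc m ⟧ * ⟦ j ⟧)                ≈⟨ -‿distribˡ-* _ _ ⟩
      ⟦ -[1+ m ] ⟧ * ⟦ j ⟧                   ∎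

    homomorphism : ℤ.+-*-rawRing -Raw-AlmostCommutative⟶ fromCommutativeRing R
    homomorphism = record
      { ⟦_⟧    = ⟦_⟧
      ; +-homo = ⟦+⟧
      ; *-homo = ⟦*⟧
      ; -‿homo = ⟦-⟧
      ; 0-homo = refl
      ; 1-homo = refl
      }

    -- Equality is tested on the integers, since that of `R` need not be decidable. A negative
    -- answer claims nothing about `R`, where distinct integers may have equal images.
    _≟_ : ∀ i j → Maybe (⟦ i ⟧ ≈ ⟦ j ⟧)
    i ≟ j = Maybe.map (λ i≡j → reflexive (≡.cong ⟦_⟧ i≡j)) (dec⇒maybe (i ℤ.≟ j))

  open RingSolver ℤ.+-*-rawRing (fromCommutativeRing R) homomorphism _≟_ public

  :0 : ∀ {n} → Polynomial n
  :0 = con (+ 0)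

  :1 : ∀ {n} → Polynomial n
  :1 = con (+ 1)

  :2 : ∀ {n} → Polynomial n
  :2 = con (+ 2)

-- Order and sign rules in an ordered field whose order need not be decidable.

module OrderedFieldProperties {c ℓ₁ ℓ₂} (ℝ : RealNumbers c ℓ₁ ℓ₂) where
  open RealNumbers ℝ
  open OrderLemmas ℝ
  open IntegerCoefficients commutativeRing
  open SetoidReasoning setoid

  -- If both strict inequalities are refuted, so is `x # y`, and tightness of apartness gives
  -- `x ≈ y`. As `_≤_` is itself a negation, the double negation still allows a three-way case split
  -- in the proof of any weak inequality.
  trichotomy-stable : ∀ x y → ¬ ¬ (x < y ⊎ x ≈ y ⊎ y < x)
  trichotomy-stable x y k = k (inj₂ (inj₁ (proj₁ (tight x y)
    (λ x#y → [ (λ x<y → k (inj₁ x<y)) , (λ y<x → k (inj₂ (inj₂ y<x))) ]′ (#⇒<⊎> x#y)))))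

  ≈⇒≤ : ∀ {x y} → x ≈ y → x ≤ y
  ≈⇒≤ x≈y = <-irrefl (sym x≈y)

  <⇒≤ : ∀ {x y} → x < y → x ≤ y
  <⇒≤ = <-asym

  ≤-antisym : ∀ {x y} → x ≤ y → y ≤ x → x ≈ y
  ≤-antisym x≤y y≤x = proj₁ (tight _ _) (λ x#y → [ y≤x , x≤y ]′ (#⇒<⊎> x#y))

  ≤-trans : ∀ {x y z} → x ≤ y → y ≤ z → x ≤ z
  ≤-trans {y = y} x≤y y≤z z<x = [ y≤z , x≤y ]′ (<-cotrans y z<x)

  ≤-respʳ-≈ : ∀ {x y z} → y ≈ z → x ≤ y → x ≤ z
  ≤-respʳ-≈ y≈z x≤y z<x = x≤y (<-respˡ-≈ (sym y≈z) z<x)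

  ≤-respˡ-≈ : ∀ {x y z} → y ≈ z → y ≤ x → z ≤ x
  ≤-respˡ-≈ y≈z y≤x x<z = y≤x (<-respʳ-≈ (sym y≈z) x<z)

  x<0⇒0<-x : ∀ {x} → x < 0# → 0# < - x
  x<0⇒0<-x x<0 = <-respʳ-≈ (+-identityˡ _) (x<y⇒0<y-x x<0)

  x≤y⇒0≤y-x : ∀ {x y} → x ≤ y → 0# ≤ y - x
  x≤y⇒0≤y-x {x} {y} x≤y y-x<0 = x≤y (0<y-x⇒x<y
    (<-respʳ-≈ (solve 2 (λ x y → :- (y :- x) := x :- y) refl x y) (x<0⇒0<-x y-x<0)))

  0≤y-x⇒x≤y : ∀ {x y} → 0# ≤ y - x → x ≤ y
  0≤y-x⇒x≤y {x} {y} 0≤y-x y<x =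
    0≤y-x (<-respʳ-≈ (-‿inverseʳ x) (+-monoˡ-< (- x) y<x))

  -- Cotransitivity at `x` splits `x + y < 0#`: either `x + y < x`, so that `y < 0#`, or `x < 0#`.
  +-nonneg : ∀ {x y} → 0# ≤ x → 0# ≤ y → 0# ≤ x + y
  +-nonneg {x} {y} 0≤x 0≤y x+y<0 =
    [ (λ x+y<x → 0≤y (<-respˡ-≈ (solve 2 (λ x y → :- x :+ (x :+ y) := y) refl x y)
        (<-respʳ-≈ (-‿inverseˡ x) (+-monoʳ-< (- x) x+y<x)))) , 0≤x ]′ (<-cotrans x x+y<0)

  +-mono-≤ : ∀ {w x y z} → w ≤ x → y ≤ z → w + y ≤ x + z
  +-mono-≤ {w} {x} {y} {z} w≤x y≤z = 0≤y-x⇒x≤y (≤-respʳ-≈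
    (solve 4 (λ w x y z → (x :- w) :+ (z :- y) := (x :+ z) :- (w :+ y)) refl w x y z)
    (+-nonneg (x≤y⇒0≤y-x w≤x) (x≤y⇒0≤y-x y≤z)))

  -- The conclusion is a negation, so the signs of `x` and `y` may be distinguished; only the
  -- strictly positive case needs `*-pos`.
  *-nonneg : ∀ {x y} → 0# ≤ x → 0# ≤ y → 0# ≤ x * y
  *-nonneg {x} {y} 0≤x 0≤y xy<0 = trichotomy-stable 0# x λ where
    (inj₂ (inj₂ x<0)) → 0≤x x<0
    (inj₂ (inj₁ 0≈x)) → <-irrefl (trans (*-congʳ (sym 0≈x)) (zeroˡ y)) xy<0
    (inj₁ 0<x)        → trichotomy-stable 0# y λ where
      (inj₂ (inj₂ y<0)) → 0≤y y<0
      (inj₂ (inj₁ 0≈y)) → <-irrefl (trans (*-congˡ (sym 0≈y)) (zeroʳ x)) xy<0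
      (inj₁ 0<y)        → <-asym xy<0 (*-pos 0<x 0<y)

  *-monoˡ-≤ : ∀ {x y z} → 0# ≤ x → y ≤ z → x * y ≤ x * z
  *-monoˡ-≤ {x} {y} {z} 0≤x y≤z = 0≤y-x⇒x≤y (≤-respʳ-≈
    (solve 3 (λ x y z → x :* (z :- y) := x :* z :- x :* y) refl x y z)
    (*-nonneg 0≤x (x≤y⇒0≤y-x y≤z)))

  *-mono-≤ : ∀ {w x y z} → 0# ≤ w → w ≤ x → 0# ≤ y → y ≤ z → w * y ≤ x * z
  *-mono-≤ 0≤w w≤x 0≤y y≤z = ≤-trans (*-monoˡ-≤ 0≤w y≤z)
    (≤-respˡ-≈ (*-comm _ _) (≤-respʳ-≈ (*-comm _ _)
      (*-monoˡ-≤ (≤-trans 0≤y y≤z) w≤x)))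

  square-nonneg : ∀ x → 0# ≤ x * x
  square-nonneg x x²<0 = trichotomy-stable 0# x λ where
    (inj₁ 0<x)        → <-asym x²<0 (*-pos 0<x 0<x)
    (inj₂ (inj₁ 0≈x)) → <-irrefl (trans (*-congʳ (sym 0≈x)) (zeroˡ x)) x²<0
    (inj₂ (inj₂ x<0)) → <-asym x²<0 (<-respʳ-≈
      (solve 1 (λ x → (:- x) :* (:- x) := x :* x) refl x) (*-pos (x<0⇒0<-x x<0) (x<0⇒0<-x x<0)))

  *-cancel-nonneg : ∀ {x y} → 0# < x → 0# ≤ x * y → 0# ≤ y
  *-cancel-nonneg {x} {y} 0<x 0≤xy y<0 = 0≤xy (0<y-x⇒x<y (<-respʳ-≈
    (solve 2 (λ x y → x :* :- y := :0 :- x :* y) refl x y)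
    (*-pos 0<x (x<0⇒0<-x y<0))))

  *-cancelˡ-≈ : ∀ {x y z} → 0# < x → x * y ≈ x * z → y ≈ z
  *-cancelˡ-≈ {x} {y} {z} 0<x xy≈xz = begin
    y            ≈⟨ sym (*-identityˡ y) ⟩
    1# * y       ≈⟨ *-congʳ (sym (inverseˡ x x#0)) ⟩
    i * x * y    ≈⟨ *-assoc i x y ⟩
    i * (x * y)  ≈⟨ *-congˡ xy≈xz ⟩
    i * (x * z)  ≈⟨ sym (*-assoc i x z) ⟩
    i * x * z    ≈⟨ *-congʳ (inverseˡ x x#0) ⟩
    1# * z       ≈⟨ *-identityˡ z ⟩
    z            ∎
    where
    x#0 = 0<⇒#0 0<x
    i = inverse x x#0

  /-cancel : ∀ {x y} (0<y : 0# < y) → (x / y ⟨ 0<y ⟩) * y ≈ x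
  /-cancel {x} {y} 0<y = trans (*-assoc x _ y)
    (trans (*-congˡ (inverseˡ y (0<⇒#0 0<y))) (*-identityʳ x))

  -- If `y < x`, both factors of `(x - y) * (x + y)` are positive. Norms are compared through this
  -- lemma, because squaring removes `√_`.
  square-cancel-≤ : ∀ {x y} → 0# ≤ x → 0# ≤ y → x * x ≤ y * y → x ≤ y
  square-cancel-≤ {x} {y} 0≤x 0≤y x²≤y² y<x = x²≤y² (0<y-x⇒x<y (<-respʳ-≈
    (solve 2 (λ x y → (x :- y) :* (x :+ y) := x :* x :- y :* y) refl x y)
    (*-pos (x<y⇒0<y-x y<x) (≤-<-trans 0≤y
      (<-respˡ-≈ (+-identityˡ y) (+-monoˡ-< y (≤-<-trans 0≤y y<x)))))))

  ^-nonneg : ∀ {x} → 0# ≤ x → ∀ n → 0# ≤ x ^ n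
  ^-nonneg 0≤x zero    = <⇒≤ 0<1
  ^-nonneg 0≤x (suc n) = *-nonneg 0≤x (^-nonneg 0≤x n)

  ^-mono-≤ : ∀ {x y} → 0# ≤ x → x ≤ y → ∀ n → x ^ n ≤ y ^ n
  ^-mono-≤ 0≤x x≤y zero    = ≈⇒≤ refl
  ^-mono-≤ 0≤x x≤y (suc n) = *-mono-≤ 0≤x x≤y (^-nonneg 0≤x n) (^-mono-≤ 0≤x x≤y n)

  sum-mono-≤ : ∀ {n} {u v : Fin n → Carrier} → (∀ i → u i ≤ v i) → sum u ≤ sum v
  sum-mono-≤ {zero}  u≤v = ≈⇒≤ refl
  sum-mono-≤ {suc n} u≤v = +-mono-≤ (u≤v Fin.zero) (sum-mono-≤ (λ i → u≤v (Fin.suc i)))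

-- Size of the Chebyshev polynomials inside and outside [-1 , 1].

module ChebyshevBounds {c ℓ₁ ℓ₂} (ℝ : RealNumbers c ℓ₁ ℓ₂) where
  open RealNumbers ℝ
  open OrderLemmas ℝ
  open OrderedFieldProperties ℝ
  open IntegerCoefficients commutativeRing
  open ChebyshevPolynomial rawRing using (T)
  open ChebyshevIteration ℝ using (T-pos; T-pos-increasing; θ; 1<θ; 0<b-a)
  open SetoidReasoning setoid

  -- u is the value at x of the Chebyshev polynomial of the second kind of degree t - 1.
  pell : ∀ x t → ∃ λ u →
    T (suc t) x ≈ x * T t x - (1# - x * x) * u ×
    T t x * T t x + (1# - x * x) * (u * u) ≈ 1#
  -- The degree is -1 here, and the second-kind polynomial of that degree is zero.
  pell x zero = 0# ,
    solve 1 (λ x → x := x :* :1 :- (:1 :- x :* x) :* :0) refl x ,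
    solve 1 (λ x → :1 :* :1 :+ (:1 :- x :* x) :* (:0 :* :0) := :1) refl x
  pell x (suc t) with pell x t
  -- With s² = x² - 1, multiplying T_t + u s by x + s gives T_{t+1} + (x u + T_t) s, which is the
  -- source of the new witness. The second identity says that the norm stays 1, since x + s has norm
  -- x² - s² = 1.
  ... | u , next , norm = x * u + T t x ,
    (begin
      2# * x * T₁ - T₀
        ≈⟨ solve 3 (λ x T₀ T₁ → :2 :* x :* T₁ :- T₀ := x :* T₁ :+ x :* T₁ :- T₀) refl x T₀ T₁ ⟩
      x * T₁ + x * T₁ - T₀
        -- Only one of the two copies of `x * T₁` is expanded; the other is the leading term of the
        -- target.
        ≈⟨ +-congʳ (+-congˡ (*-congˡ next)) ⟩
      x * T₁ + x * (x * T₀ - (1# - x * x) * u) - T₀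
        ≈⟨ solve 4 (λ x u T₀ T₁ →
             x :* T₁ :+ x :* (x :* T₀ :- (:1 :- x :* x) :* u) :- T₀
             := x :* T₁ :- (:1 :- x :* x) :* (x :* u :+ T₀)) refl x u T₀ T₁ ⟩
      x * T₁ - (1# - x * x) * (x * u + T₀) ∎) ,
    (begin
      T₁ * T₁ + (1# - x * x) * ((x * u + T₀) * (x * u + T₀))
        ≈⟨ +-congʳ (*-cong next next) ⟩
      (x * T₀ - (1# - x * x) * u) * (x * T₀ - (1# - x * x) * u)
        + (1# - x * x) * ((x * u + T₀) * (x * u + T₀))
        ≈⟨ solve 3 (λ x u T₀ →
             (x :* T₀ :- (:1 :- x :* x) :* u) :* (x :* T₀ :- (:1 :- x :* x) :* u)
             :+ (:1 :- x :* x) :* ((x :* u :+ T₀) :* (x :* u :+ T₀))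
             := T₀ :* T₀ :+ (:1 :- x :* x) :* (u :* u)) refl x u T₀ ⟩
      T₀ * T₀ + (1# - x * x) * (u * u)
        ≈⟨ norm ⟩
      1# ∎)
    where
    T₀ = T t x
    T₁ = T (suc t) x

  -- The Pell identity makes `1# - T t x * T t x` equal to a product of nonnegative terms. Squares
  -- take the place of absolute values.
  T²≤1 : ∀ {x} → x * x ≤ 1# → ∀ t → T t x * T t x ≤ 1#
  T²≤1 {x} x²≤1 t with pell x t
  ... | u , _ , norm = 0≤y-x⇒x≤y (≤-respʳ-≈ (begin
      (1# - x * x) * (u * u)
        ≈⟨ solve 2 (λ T w → w := T :* T :+ w :- T :* T) refl (T t x) _ ⟩
      T t x * T t x + (1# - x * x) * (u * u) - T t x * T t x
        ≈⟨ +-congʳ norm ⟩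
      1# - T t x * T t x ∎)
    (*-nonneg (x≤y⇒0≤y-x x²≤1) (square-nonneg u)))

  -- Growth of `T t x` in `t` at the point `x` with `ζ * x ≈ 2#`.

  module _ {ζ x} (0≤ζ : 0# ≤ ζ) (ζ≤1 : ζ ≤ 1#) (1<x : 1# < x) (ζx≈2 : ζ * x ≈ 2#) where

    -- Multiplying the recurrence by `ζ` turns the coefficient `2# * x` into the constant four. The
    -- subtracted term is then absorbed, because `T` increases with the degree and `ζ ≤ 1#`.
    T≤ζT : ∀ t → T t x ≤ ζ * T (suc t) x
    T≤ζT zero = ≤-respʳ-≈ (sym ζx≈2)
      (<⇒≤ (<-respˡ-≈ (+-identityʳ 1#) (+-monoʳ-< 1# 0<1)))
    T≤ζT (suc t) = 0≤y-x⇒x≤y (≤-respʳ-≈ (begin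
        -- The surplus 3 T₁ - ζ T₀, arranged as a sum of visibly nonnegative terms.
        T₁ + T₁ + ((T₁ - T₀) + (1# - ζ) * T₀)
          ≈⟨ solve 3 (λ ζ T₀ T₁ → T₁ :+ T₁ :+ ((T₁ :- T₀) :+ (:1 :- ζ) :* T₀)
               := :2 :* :2 :* T₁ :- ζ :* T₀ :- T₁) refl ζ T₀ T₁ ⟩
        2# * 2# * T₁ - ζ * T₀ - T₁
          ≈⟨ +-congʳ (+-congʳ (*-congʳ (*-congˡ (sym ζx≈2)))) ⟩
        2# * (ζ * x) * T₁ - ζ * T₀ - T₁
          ≈⟨ solve 4 (λ ζ x T₀ T₁ → :2 :* (ζ :* x) :* T₁ :- ζ :* T₀ :- T₁
               := ζ :* (:2 :* x :* T₁ :+ :- T₀) :- T₁) refl ζ x T₀ T₁ ⟩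
        ζ * T (suc (suc t)) x - T₁ ∎)
      (+-nonneg (+-nonneg 0≤T₁ 0≤T₁)
        (+-nonneg (<⇒≤ (x<y⇒0<y-x (proj₂ (T-pos-increasing 1<x t))))
          (*-nonneg (x≤y⇒0≤y-x ζ≤1) (<⇒≤ (T-pos 1<x t))))))
      where
      T₀ = T t x
      T₁ = T (suc t) x
      0≤T₁ = <⇒≤ (T-pos 1<x (suc t))

    -- By `T≤ζT` the sequence `ζ ^ t * T t x` never decreases, and it starts at 1.
    1≤ζ^tT : ∀ t → 1# ≤ ζ ^ t * T t x
    1≤ζ^tT zero    = ≈⇒≤ (sym (*-identityˡ 1#))
    1≤ζ^tT (suc t) = ≤-trans (1≤ζ^tT t) (≤-respʳ-≈
      (solve 3 (λ ζ w T → w :* (ζ :* T) := ζ :* w :* T) refl ζ (ζ ^ t) (T (suc t) x))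
      (*-monoˡ-≤ (^-nonneg 0≤ζ t) (T≤ζT t)))

    1/T≤ζ^t : ∀ t → 1# / T t x ⟨ T-pos 1<x t ⟩ ≤ ζ ^ t
    1/T≤ζ^t t = ≤-respˡ-≈ (*-identityʳ i) (≤-respʳ-≈ (begin
        i * (ζ ^ t * T t x)  ≈⟨ solve 3 (λ i w T → i :* (w :* T) := w :* (i :* T)) refl i _ _ ⟩
        ζ ^ t * (i * T t x)  ≈⟨ *-congˡ (/-cancel (T-pos 1<x t)) ⟩
        ζ ^ t * 1#           ≈⟨ *-identityʳ _ ⟩
        ζ ^ t                ∎)
      (*-monoˡ-≤ (<⇒≤ (/-pos 0<1 (T-pos 1<x t))) (1≤ζ^tT t)))
      where i = 1# / T t x ⟨ T-pos 1<x t ⟩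

  -- Dependence of the spectral interval on `ζ`.

  module _ {a b ζ} (a[2+ζ]≈2 : a * (2# + ζ) ≈ 2#) (b[2-ζ]≈2 : b * (2# - ζ) ≈ 2#) where

    -- Subtracting the two equations that define the endpoints cancels the constant 2. This is (b +
    -- a) / (b - a) = 2 / ζ with denominators cleared, so it remains meaningful when `ζ ≈ 0#` and
    -- the interval collapses.
    2[b-a]≈ζ[b+a] : 2# * (b - a) ≈ ζ * (b + a)
    2[b-a]≈ζ[b+a] = begin
      2# * (b - a)
        ≈⟨ solve 3 (λ a b ζ → :2 :* (b :- a)
             := (b :* (:2 :- ζ) :- a :* (:2 :+ ζ)) :+ ζ :* (b :+ a)) refl a b ζ ⟩
      (b * (2# - ζ) - a * (2# + ζ)) + ζ * (b + a)
        ≈⟨ +-congʳ (+-cong b[2-ζ]≈2 (-‿cong a[2+ζ]≈2)) ⟩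
      (2# - 2#) + ζ * (b + a)
        ≈⟨ solve 1 (λ w → (:2 :- :2) :+ w := w) refl _ ⟩
      ζ * (b + a) ∎

    0<ζ⇒a<b : 0# < a → 0# < b → 0# < ζ → a < b
    0<ζ⇒a<b 0<a 0<b 0<ζ = 0<y-x⇒x<y (<-respʳ-≈ half
      (*-pos (/-pos 0<1 0<2) (<-respʳ-≈ (sym 2[b-a]≈ζ[b+a]) (*-pos 0<ζ (+-pos 0<b 0<a)))))
      where
      half : (1# / 2# ⟨ 0<2 ⟩) * (2# * (b - a)) ≈ b - a
      half = trans (sym (*-assoc _ _ _)) (trans (*-congʳ (/-cancel 0<2)) (*-identityˡ _))

    ζ≈0⇒a≈b : ζ ≈ 0# → a ≈ b
    ζ≈0⇒a≈b ζ≈0 = *-cancelˡ-≈ 0<2 (begin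
      2# * a
        ≈⟨ solve 2 (λ a b → :2 :* a := :2 :* b :- :2 :* (b :- a)) refl a b ⟩
      2# * b - 2# * (b - a)  ≈⟨ +-congˡ (-‿cong (trans 2[b-a]≈ζ[b+a] (*-congʳ ζ≈0))) ⟩
      2# * b - 0# * (b + a)  ≈⟨ solve 2 (λ a b → :2 :* b :- :0 :* (b :+ a) := :2 :* b) refl a b ⟩
      2# * b ∎)

    ζθ≈2 : (0<a : 0# < a) (a<b : a < b) → ζ * θ 0<a a<b ≈ 2#
    ζθ≈2 0<a a<b = *-cancelˡ-≈ (0<b-a 0<a a<b) (begin
      (b - a) * (ζ * θ 0<a a<b)
        ≈⟨ solve 3 (λ d ζ θ → d :* (ζ :* θ) := ζ :* (θ :* d)) refl (b - a) ζ (θ 0<a a<b) ⟩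
      ζ * (θ 0<a a<b * (b - a))
        ≈⟨ *-congˡ (/-cancel (0<b-a 0<a a<b)) ⟩
      ζ * (b + a)
        ≈⟨ sym 2[b-a]≈ζ[b+a] ⟩
      2# * (b - a)
        ≈⟨ *-comm _ _ ⟩
      (b - a) * 2# ∎)

  -- The scalar residual polynomial on the spectral interval.

  module _ {a b} (0<a : 0# < a) (a<b : a < b) where

    -- The image of x under the affine map that takes [a , b] to [1 , - 1]
    rescale : Carrier → Carrier
    rescale x = (1# / (b - a) ⟨ 0<b-a 0<a a<b ⟩) * ((b + a) * 1# - 2# * x)

    -- Factor 1 - y² as (1 - y)(1 + y) for `y = rescale x`. Multiplied by `b - a`, the factors
    -- become twice the distances from `x` to the two endpoints.
    rescale²≤1 : ∀ {x} → a ≤ x → x ≤ b → rescale x * rescale x ≤ 1#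
    rescale²≤1 {x} a≤x x≤b = 0≤y-x⇒x≤y (≤-respʳ-≈
      (solve 1 (λ y → (:1 :- y) :* (:1 :+ y) := :1 :- y :* y) refl y)
      (*-nonneg
        (*-cancel-nonneg 0<d (≤-respʳ-≈ (sym lower) (*-nonneg (<⇒≤ 0<2) (x≤y⇒0≤y-x a≤x))))
        (*-cancel-nonneg 0<d (≤-respʳ-≈ (sym upper) (*-nonneg (<⇒≤ 0<2) (x≤y⇒0≤y-x x≤b))))))
      where
      0<d = 0<b-a 0<a a<b
      i = 1# / (b - a) ⟨ 0<d ⟩
      y = rescale x
      dy : (b - a) * y ≈ (b + a) - 2# * x
      dy = begin
        (b - a) * (i * ((b + a) * 1# - 2# * x))
          ≈⟨ solve 3 (λ d i w → d :* (i :* w) := i :* d :* w) refl (b - a) i _ ⟩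
        i * (b - a) * ((b + a) * 1# - 2# * x)
          ≈⟨ *-congʳ (/-cancel 0<d) ⟩
        1# * ((b + a) * 1# - 2# * x)
          ≈⟨ solve 3 (λ a b x → :1 :* ((b :+ a) :* :1 :- :2 :* x) := (b :+ a) :- :2 :* x) refl a b x ⟩
        (b + a) - 2# * x ∎
      lower : (b - a) * (1# - y) ≈ 2# * (x - a)
      lower = begin
        (b - a) * (1# - y)              ≈⟨ solve 2 (λ d y → d :* (:1 :- y) := d :- d :* y) refl (b - a) y ⟩
        (b - a) - (b - a) * y           ≈⟨ +-congˡ (-‿cong dy) ⟩
        (b - a) - ((b + a) - 2# * x)    ≈⟨ solve 3 (λ a b x → (b :- a) :- ((b :+ a) :- :2 :* x)
                                             := :2 :* (x :- a)) refl a b x ⟩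
        2# * (x - a) ∎
      upper : (b - a) * (1# + y) ≈ 2# * (b - x)
      upper = begin
        (b - a) * (1# + y)              ≈⟨ solve 2 (λ d y → d :* (:1 :+ y) := d :+ d :* y) refl (b - a) y ⟩
        (b - a) + (b - a) * y           ≈⟨ +-congˡ dy ⟩
        (b - a) + ((b + a) - 2# * x)    ≈⟨ solve 3 (λ a b x → (b :- a) :+ ((b :+ a) :- :2 :* x)
                                             := :2 :* (b :- x)) refl a b x ⟩
        2# * (b - x) ∎

    -- The eigenvalue of `P` that belongs to an eigenvalue `x` of the matrix. The factor `* 1#`
    -- inside `rescale` is the eigenvalue of `1ᴹ`, kept so that `P-diagonalised` needs no rewriting.
    residualFactor : ℕ → Carrier → Carrier
    residualFactor t x = (1# / T t (θ 0<a a<b) ⟨ T-pos (1<θ 0<a a<b) t ⟩) * T t (rescale x)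

    -- The denominator contributes `1/T≤ζ^t` and the numerator `T²≤1`. The bound is on squares,
    -- since the numerator may have either sign and the norm only involves squares.
    residualFactor-bound : ∀ {ζ} → 0# ≤ ζ → ζ ≤ 1# → ζ * θ 0<a a<b ≈ 2# →
      ∀ t {x} → a ≤ x → x ≤ b → residualFactor t x * residualFactor t x ≤ ζ ^ t * ζ ^ t
    residualFactor-bound 0≤ζ ζ≤1 ζθ≈2 t {x} a≤x x≤b =
      ≤-respˡ-≈ (solve 2 (λ i w → (i :* i) :* (w :* w) := (i :* w) :* (i :* w)) refl i _)
      (≤-respʳ-≈ (*-identityʳ _)
        (*-mono-≤ (square-nonneg i) (*-mono-≤ 0≤i i≤ζ^t 0≤i i≤ζ^t)
          (square-nonneg _) (T²≤1 (rescale²≤1 a≤x x≤b) t)))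
      where
      i = 1# / T t (θ 0<a a<b) ⟨ T-pos (1<θ 0<a a<b) t ⟩
      0≤i = <⇒≤ (/-pos 0<1 (T-pos (1<θ 0<a a<b) t))
      i≤ζ^t = 1/T≤ζ^t 0≤ζ ζ≤1 (1<θ 0<a a<b) ζθ≈2 t

-- Matrix actions, orthogonal diagonalisation and norms.

module LinearAlgebraProperties {c ℓ₁ ℓ₂} (ℝ : RealNumbers c ℓ₁ ℓ₂) where
  open RealNumbers ℝ
  open OrderedFieldProperties ℝ
  open LinearAlgebra ℝ
  open IntegerCoefficients commutativeRing using (solve; _:=_; _:+_; _:*_; :-_; :1)
  open SumProperties (CommutativeRing.semiring commutativeRing)
    using (sum-cong-≋; *-distribˡ-sum; *-distribʳ-sum; ∑-distrib-+; ∑-comm; sum-replicate-zero)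
  open SetoidReasoning setoid

  private variable
    k m n : ℕ

  ∙-congˡ : (u : ℝ^ n) {v w : ℝ^ n} → v ≈ᵛ w → u ∙ v ≈ u ∙ w
  ∙-congˡ u v≈w = sum-cong-≋ (λ i → *-congˡ (v≈w i))

  ∙-congʳ : {u v : ℝ^ n} (w : ℝ^ n) → u ≈ᵛ v → u ∙ w ≈ v ∙ w
  ∙-congʳ w u≈v = sum-cong-≋ (λ i → *-congʳ (u≈v i))

  ∙-cong : {u v w x : ℝ^ n} → u ≈ᵛ v → w ≈ᵛ x → u ∙ w ≈ v ∙ x
  ∙-cong u≈v w≈x = sum-cong-≋ (λ i → *-cong (u≈v i) (w≈x i))

  ∙-nonneg : (v : ℝ^ n) → 0# ≤ v ∙ v
  ∙-nonneg {n} v = ≤-respˡ-≈ (sum-replicate-zero n) (sum-mono-≤ (λ i → square-nonneg (v i)))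

  *ᵛ-congˡ : (A : Matrix m n) {u v : ℝ^ n} → u ≈ᵛ v → A *ᵛ u ≈ᵛ A *ᵛ v
  *ᵛ-congˡ A u≈v i = ∙-congˡ (A i) u≈v

  *ᵛ-congʳ : {A B : Matrix m n} (v : ℝ^ n) → A ≈ᴹ B → A *ᵛ v ≈ᵛ B *ᵛ v
  *ᵛ-congʳ v A≈B i = ∙-congʳ v (A≈B i)

  *ᴹ-*ᵛ : (A : Matrix m k) (B : Matrix k n) (v : ℝ^ n) → (A *ᴹ B) *ᵛ v ≈ᵛ A *ᵛ (B *ᵛ v)
  *ᴹ-*ᵛ A B v i = begin
    sum (λ j → sum (λ l → A i l * B l j) * v j)
      ≈⟨ sum-cong-≋ (λ j → *-distribʳ-sum (v j) (λ l → A i l * B l j)) ⟩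
    sum (λ j → sum (λ l → A i l * B l j * v j))
      ≈⟨ ∑-comm (λ j l → A i l * B l j * v j) ⟩
    sum (λ l → sum (λ j → A i l * B l j * v j))
      ≈⟨ sum-cong-≋ (λ l → sum-cong-≋ (λ j → *-assoc (A i l) (B l j) (v j))) ⟩
    sum (λ l → sum (λ j → A i l * (B l j * v j)))
      ≈⟨ sum-cong-≋ (λ l → sym (*-distribˡ-sum (A i l) (λ j → B l j * v j))) ⟩
    sum (λ l → A i l * sum (λ j → B l j * v j)) ∎

  ᵀ-*ᴹ : (A : Matrix m k) (B : Matrix k n) → (A *ᴹ B) ᵀ ≈ᴹ B ᵀ *ᴹ A ᵀ
  ᵀ-*ᴹ A B i j = sum-cong-≋ (λ l → *-comm (A j l) (B l i))

  adjoint : (A : Matrix m n) (u : ℝ^ n) (v : ℝ^ m) → (A *ᵛ u) ∙ v ≈ u ∙ (A ᵀ *ᵛ v)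
  adjoint A u v = begin
    sum (λ i → sum (λ j → A i j * u j) * v i)
      ≈⟨ sum-cong-≋ (λ i → *-distribʳ-sum (v i) (λ j → A i j * u j)) ⟩
    sum (λ i → sum (λ j → A i j * u j * v i))
      ≈⟨ ∑-comm (λ i j → A i j * u j * v i) ⟩
    sum (λ j → sum (λ i → A i j * u j * v i))
      ≈⟨ sum-cong-≋ (λ j → sum-cong-≋ (λ i →
           solve 3 (λ A u v → A :* u :* v := u :* (A :* v)) refl (A i j) (u j) (v i))) ⟩
    sum (λ j → sum (λ i → u j * (A i j * v i)))
      ≈⟨ sum-cong-≋ (λ j → sym (*-distribˡ-sum (u j) (λ i → A i j * v i))) ⟩
    sum (λ j → u j * sum (λ i → A i j * v i)) ∎

  -- The entries `x j` may vary with `j`: constant `x` serves `1ᴹ` and the rows of a rectangular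
  -- diagonal matrix, while `x = σ` serves its transpose.
  ∑-indicator : (i : Fin n) (x v : ℝ^ n) →
    sum (λ j → (if does (i Fin.≟ j) then x j else 0#) * v j) ≈ x i * v i
  ∑-indicator {suc n} Fin.zero x v = trans
    (+-congˡ (trans (sum-cong-≋ (λ j → zeroˡ (v (Fin.suc j)))) (sum-replicate-zero n)))
    (+-identityʳ _)
  ∑-indicator {suc n} (Fin.suc i) x v = trans (+-congʳ (zeroˡ (v Fin.zero)))
    (trans (+-identityˡ _) (∑-indicator i (λ j → x (Fin.suc j)) (λ j → v (Fin.suc j))))

  1ᴹ-*ᵛ : (v : ℝ^ n) → 1ᴹ *ᵛ v ≈ᵛ v
  1ᴹ-*ᵛ v i = trans (∑-indicator i (λ _ → 1#) v) (*-identityˡ (v i))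

  rectangularDiagonal-square : (m≤n : m ≤ℕ n) (σ v : ℝ^ m) → ∀ i →
    (rectangularDiagonal m≤n σ *ᵛ (rectangularDiagonal m≤n σ ᵀ *ᵛ v)) i ≈ σ i ^ 2 * v i
  rectangularDiagonal-square m≤n σ v i = begin
    (rectangularDiagonal m≤n σ *ᵛ Σᵀv) i      ≈⟨ ∑-indicator (inject≤ i m≤n) (λ _ → σ i) Σᵀv ⟩
    σ i * Σᵀv (inject≤ i m≤n)                 ≈⟨ *-congˡ Σᵀv-inject ⟩
    -- The power `σ i ^ 2` unfolds to `σ i * (σ i * 1#)`.
    σ i * (σ i * v i)                         ≈⟨ solve 2 (λ s v → s :* (s :* v) := s :* (s :* :1) :* v) refl (σ i) (v i) ⟩
    σ i ^ 2 * v i                             ∎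
    where
    Σᵀv = rectangularDiagonal m≤n σ ᵀ *ᵛ v
    Σᵀv-inject : Σᵀv (inject≤ i m≤n) ≈ σ i * v i
    Σᵀv-inject = trans
      -- The sum runs over the rows `j` of the diagonal matrix, so the test compares two injected
      -- indices; injectivity of `inject≤` reduces it to `i Fin.≟ j`.
      (sum-cong-≋ (λ j → *-congʳ (reflexive (≡.cong (if_then σ j else 0#)
        (does-⇔ (mk⇔ (λ eq → ≡.sym (Fin.inject≤-injective m≤n m≤n j i eq))
                     (λ eq → ≡.cong (λ l → inject≤ l m≤n) (≡.sym eq)))
          (inject≤ j m≤n Fin.≟ inject≤ i m≤n) (i Fin.≟ j))))))
      (∑-indicator i σ v)

  *ᵛ-+ᴹ : (A B : Matrix m n) (v : ℝ^ n) → ∀ i → ((A +ᴹ B) *ᵛ v) i ≈ (A *ᵛ v) i + (B *ᵛ v) i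
  *ᵛ-+ᴹ A B v i = trans (sum-cong-≋ (λ j → distribʳ (v j) (A i j) (B i j)))
    (∑-distrib-+ (λ j → A i j * v j) (λ j → B i j * v j))

  *ᵛ-·ᴹ : (x : Carrier) (A : Matrix m n) (v : ℝ^ n) → ∀ i → ((x ·ᴹ A) *ᵛ v) i ≈ x * (A *ᵛ v) i
  *ᵛ-·ᴹ x A v i = trans (sum-cong-≋ (λ j → *-assoc x (A i j) (v j)))
    (sym (*-distribˡ-sum x (λ j → A i j * v j)))

  *ᵛ--ᴹ : (A : Matrix m n) (v : ℝ^ n) → ∀ i → ((-ᴹ A) *ᵛ v) i ≈ - (A *ᵛ v) i
  *ᵛ--ᴹ A v i = begin
    ((-ᴹ A) *ᵛ v) i            ≈⟨ ∙-congʳ v (λ j → solve 1 (λ x → :- x := :- :1 :* x) refl (A i j)) ⟩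
    ((- 1# ·ᴹ A) *ᵛ v) i       ≈⟨ *ᵛ-·ᴹ (- 1#) A v i ⟩
    - 1# * (A *ᵛ v) i          ≈⟨ solve 1 (λ x → :- :1 :* x := :- x) refl _ ⟩
    - (A *ᵛ v) i               ∎

  *ᵛ-+ : (A : Matrix m n) (u v : ℝ^ n) → ∀ i →
    (A *ᵛ (λ j → u j + v j)) i ≈ (A *ᵛ u) i + (A *ᵛ v) i
  *ᵛ-+ A u v i = trans (sum-cong-≋ (λ j → distribˡ (A i j) (u j) (v j)))
    (∑-distrib-+ (λ j → A i j * u j) (λ j → A i j * v j))

  *ᵛ-* : (A : Matrix m n) (x : Carrier) (v : ℝ^ n) → ∀ i →
    (A *ᵛ (λ j → x * v j)) i ≈ x * (A *ᵛ v) i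
  *ᵛ-* A x v i = trans
    (sum-cong-≋ (λ j → solve 3 (λ A x v → A :* (x :* v) := x :* (A :* v)) refl (A i j) x (v j)))
    (sym (*-distribˡ-sum x (λ j → A i j * v j)))

  *ᵛ-- : (A : Matrix m n) (v : ℝ^ n) → ∀ i → (A *ᵛ (λ j → - v j)) i ≈ - (A *ᵛ v) i
  *ᵛ-- A v i = begin
    (A *ᵛ (λ j → - v j)) i         ≈⟨ ∙-congˡ (A i) (λ j → solve 1 (λ x → :- x := :- :1 :* x) refl (v j)) ⟩
    (A *ᵛ (λ j → - 1# * v j)) i    ≈⟨ *ᵛ-* A (- 1#) v i ⟩
    - 1# * (A *ᵛ v) i              ≈⟨ solve 1 (λ x → :- :1 :* x := :- x) refl _ ⟩
    - (A *ᵛ v) i                   ∎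

  -- The rows of W are left eigenvectors of M with eigenvalues μ.
  Diagonalises : Matrix m m → Matrix m m → ℝ^ m → Set _
  Diagonalises {m} W M μ = ∀ (v : ℝ^ m) i → (W *ᵛ (M *ᵛ v)) i ≈ μ i * (W *ᵛ v) i

  module _ {W : Matrix m m} where

    diagonalises-1ᴹ : Diagonalises W 1ᴹ (λ _ → 1#)
    diagonalises-1ᴹ v i = trans (*ᵛ-congˡ W (1ᴹ-*ᵛ v) i) (sym (*-identityˡ _))

    diagonalises-+ᴹ : ∀ {M N μ ν} → Diagonalises W M μ → Diagonalises W N ν →
                      Diagonalises W (M +ᴹ N) (λ i → μ i + ν i)
    diagonalises-+ᴹ {M} {N} {μ} {ν} dM dN v i = begin
      (W *ᵛ ((M +ᴹ N) *ᵛ v)) i                          ≈⟨ *ᵛ-congˡ W (*ᵛ-+ᴹ M N v) i ⟩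
      (W *ᵛ (λ j → (M *ᵛ v) j + (N *ᵛ v) j)) i          ≈⟨ *ᵛ-+ W (M *ᵛ v) (N *ᵛ v) i ⟩
      (W *ᵛ (M *ᵛ v)) i + (W *ᵛ (N *ᵛ v)) i             ≈⟨ +-cong (dM v i) (dN v i) ⟩
      μ i * (W *ᵛ v) i + ν i * (W *ᵛ v) i               ≈⟨ distribʳ _ _ _ ⟨
      (μ i + ν i) * (W *ᵛ v) i                          ∎

    diagonalises--ᴹ : ∀ {M μ} → Diagonalises W M μ → Diagonalises W (-ᴹ M) (λ i → - μ i)
    diagonalises--ᴹ {M} {μ} dM v i = begin
      (W *ᵛ ((-ᴹ M) *ᵛ v)) i                            ≈⟨ *ᵛ-congˡ W (*ᵛ--ᴹ M v) i ⟩
      (W *ᵛ (λ j → - (M *ᵛ v) j)) i                     ≈⟨ *ᵛ-- W (M *ᵛ v) i ⟩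
      - (W *ᵛ (M *ᵛ v)) i                               ≈⟨ -‿cong (dM v i) ⟩
      - (μ i * (W *ᵛ v) i)                              ≈⟨ solve 2 (λ μ w → :- (μ :* w) := :- μ :* w) refl (μ i) _ ⟩
      - μ i * (W *ᵛ v) i                                ∎

    diagonalises-·ᴹ : ∀ x {M μ} → Diagonalises W M μ → Diagonalises W (x ·ᴹ M) (λ i → x * μ i)
    diagonalises-·ᴹ x {M} {μ} dM v i = begin
      (W *ᵛ ((x ·ᴹ M) *ᵛ v)) i                          ≈⟨ *ᵛ-congˡ W (*ᵛ-·ᴹ x M v) i ⟩
      (W *ᵛ (λ j → x * (M *ᵛ v) j)) i                   ≈⟨ *ᵛ-* W x (M *ᵛ v) i ⟩
      x * (W *ᵛ (M *ᵛ v)) i                             ≈⟨ *-congˡ (dM v i) ⟩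
      x * (μ i * (W *ᵛ v) i)                            ≈⟨ *-assoc _ _ _ ⟨
      x * μ i * (W *ᵛ v) i                              ∎

    -- The hypothesis on `M` is applied at the vector `N *ᵛ v`; the quantification over all vectors
    -- in `Diagonalises` makes products compose.
    diagonalises-*ᴹ : ∀ {M N μ ν} → Diagonalises W M μ → Diagonalises W N ν →
                      Diagonalises W (M *ᴹ N) (λ i → μ i * ν i)
    diagonalises-*ᴹ {M} {N} {μ} {ν} dM dN v i = begin
      (W *ᵛ ((M *ᴹ N) *ᵛ v)) i                          ≈⟨ *ᵛ-congˡ W (*ᴹ-*ᵛ M N v) i ⟩
      (W *ᵛ (M *ᵛ (N *ᵛ v))) i                          ≈⟨ dM (N *ᵛ v) i ⟩
      μ i * (W *ᵛ (N *ᵛ v)) i                           ≈⟨ *-congˡ (dN v i) ⟩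
      μ i * (ν i * (W *ᵛ v) i)                          ≈⟨ *-assoc _ _ _ ⟨
      μ i * ν i * (W *ᵛ v) i                            ∎

    diagonalises-^ᴹ : ∀ {M μ} → Diagonalises W M μ → ∀ t → Diagonalises W (M ^ᴹ t) (λ i → μ i ^ t)
    diagonalises-^ᴹ dM zero    = diagonalises-1ᴹ
    diagonalises-^ᴹ dM (suc t) = diagonalises-*ᴹ dM (diagonalises-^ᴹ dM t)

    open ChebyshevPolynomial rawRing using (T)
    open ChebyshevPolynomial (matrixRawRing m) using () renaming (T to Tᴹ)

    -- A polynomial in `M` keeps the eigenvectors of `M`. The constant two of the matrix recurrence
    -- is `1ᴹ +ᴹ 1ᴹ`, with eigenvalue `1# + 1#`, so the eigenvalues satisfy the scalar recurrence
    -- literally.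
    diagonalises-T : ∀ {M μ} → Diagonalises W M μ → ∀ t → Diagonalises W (Tᴹ t M) (λ i → T t (μ i))
    diagonalises-T dM zero          = diagonalises-1ᴹ
    diagonalises-T dM (suc zero)    = dM
    diagonalises-T dM (suc (suc t)) = diagonalises-+ᴹ
      (diagonalises-*ᴹ (diagonalises-*ᴹ (diagonalises-+ᴹ diagonalises-1ᴹ diagonalises-1ᴹ) dM)
        (diagonalises-T dM (suc t)))
      (diagonalises--ᴹ (diagonalises-T dM t))

  orthogonalᵀ-isometry : ∀ {U : Matrix m m} → IsOrthogonal U → ∀ v → (U ᵀ *ᵛ v) ∙ (U ᵀ *ᵛ v) ≈ v ∙ v
  orthogonalᵀ-isometry {U = U} orth v = begin
    (U ᵀ *ᵛ v) ∙ (U ᵀ *ᵛ v)       ≈⟨ adjoint (U ᵀ) v (U ᵀ *ᵛ v) ⟩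
    v ∙ (U *ᵛ (U ᵀ *ᵛ v))         ≈⟨ ∙-congˡ v (λ i → *ᴹ-*ᵛ U (U ᵀ) v i) ⟨
    v ∙ ((U *ᴹ U ᵀ) *ᵛ v)         ≈⟨ ∙-congˡ v (*ᵛ-congʳ v (IsOrthogonal.orthogonalʳ orth)) ⟩
    v ∙ (1ᴹ *ᵛ v)                 ≈⟨ ∙-congˡ v (1ᴹ-*ᵛ v) ⟩
    v ∙ v                         ∎

  -- Passing to the coordinates `U ᵀ *ᵛ q` preserves the norm, and there `N` scales the `i`-th
  -- coordinate by `μ i`. The squared norms are therefore compared term by term.
  ∥∥₂-diagonalised-≤ : ∀ {U N : Matrix m m} {μ} → IsOrthogonal U → Diagonalises (U ᵀ) N μ →
    ∀ {x} → 0# ≤ x → (∀ i → μ i * μ i ≤ x * x) →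
    ∀ {q r} → r ≈ᵛ -ᵛ (N *ᵛ q) → ∥ r ∥₂ ≤ x * ∥ q ∥₂
  ∥∥₂-diagonalised-≤ {U = U} {N} {μ} orth dN {x} 0≤x μ²≤x² {q} {r} r≈-Nq =
    square-cancel-≤ (√-nonneg _) (*-nonneg 0≤x (√-nonneg _))
      (≤-respˡ-≈ (sym lhs) (≤-respʳ-≈ rhs (sum-mono-≤ (λ i →
        ≤-respʳ-≈ (*-comm _ _) (≤-respˡ-≈ (*-comm _ _)
          (*-monoˡ-≤ (square-nonneg (w i)) (μ²≤x² i)))))))
    where
    w = U ᵀ *ᵛ q
    lhs : ∥ r ∥₂ * ∥ r ∥₂ ≈ sum (λ i → (μ i * μ i) * (w i * w i))
    lhs = begin
      ∥ r ∥₂ * ∥ r ∥₂                              ≈⟨ √-square _ (∙-nonneg r) ⟩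
      r ∙ r                                        ≈⟨ ∙-cong r≈-Nq r≈-Nq ⟩
      (-ᵛ (N *ᵛ q)) ∙ (-ᵛ (N *ᵛ q))                ≈⟨ sum-cong-≋ (λ i →
                                                        solve 1 (λ x → (:- x) :* (:- x) := x :* x) refl ((N *ᵛ q) i)) ⟩
      (N *ᵛ q) ∙ (N *ᵛ q)                          ≈⟨ orthogonalᵀ-isometry orth (N *ᵛ q) ⟨
      (U ᵀ *ᵛ (N *ᵛ q)) ∙ (U ᵀ *ᵛ (N *ᵛ q))        ≈⟨ ∙-cong (dN q) (dN q) ⟩
      sum (λ i → (μ i * w i) * (μ i * w i))        ≈⟨ sum-cong-≋ (λ i →
                                                        solve 2 (λ μ w → (μ :* w) :* (μ :* w) := (μ :* μ) :* (w :* w)) refl (μ i) (w i)) ⟩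
      sum (λ i → (μ i * μ i) * (w i * w i))        ∎
    rhs : sum (λ i → (x * x) * (w i * w i)) ≈ (x * ∥ q ∥₂) * (x * ∥ q ∥₂)
    rhs = begin
      sum (λ i → (x * x) * (w i * w i))            ≈⟨ *-distribˡ-sum (x * x) (λ i → w i * w i) ⟨
      (x * x) * (w ∙ w)                            ≈⟨ *-congˡ (orthogonalᵀ-isometry orth q) ⟩
      (x * x) * (q ∙ q)                            ≈⟨ *-congˡ (√-square _ (∙-nonneg q)) ⟨
      (x * x) * (∥ q ∥₂ * ∥ q ∥₂)                  ≈⟨ solve 2 (λ x q → (x :* x) :* (q :* q) := (x :* q) :* (x :* q)) refl x _ ⟩
      (x * ∥ q ∥₂) * (x * ∥ q ∥₂)                  ∎

  -- From singular values of `B` to eigenvalues of `B Bᵀ`.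

  module _ {m≤n : m ≤ℕ n} {B : Matrix m n} {σ : ℝ^ m} (sv : AreSingularValues m≤n B σ) where
    open AreSingularValues sv
    private
      Σ = rectangularDiagonal m≤n σ

      B-action : ∀ v → B *ᵛ v ≈ᵛ U *ᵛ (Σ *ᵛ (V ᵀ *ᵛ v))
      B-action v i = begin
        (B *ᵛ v) i                               ≈⟨ *ᵛ-congʳ v factorises i ⟩
        ((U *ᴹ Σ *ᴹ V ᵀ) *ᵛ v) i                 ≈⟨ *ᴹ-*ᵛ (U *ᴹ Σ) (V ᵀ) v i ⟩
        ((U *ᴹ Σ) *ᵛ (V ᵀ *ᵛ v)) i               ≈⟨ *ᴹ-*ᵛ U Σ (V ᵀ *ᵛ v) i ⟩
        (U *ᵛ (Σ *ᵛ (V ᵀ *ᵛ v))) i               ∎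

      Bᵀ-action : ∀ v → B ᵀ *ᵛ v ≈ᵛ V *ᵛ (Σ ᵀ *ᵛ (U ᵀ *ᵛ v))
      Bᵀ-action v i = begin
        (B ᵀ *ᵛ v) i                             ≈⟨ *ᵛ-congʳ v (λ i j → factorises j i) i ⟩
        ((U *ᴹ Σ *ᴹ V ᵀ) ᵀ *ᵛ v) i               ≈⟨ *ᵛ-congʳ v (ᵀ-*ᴹ (U *ᴹ Σ) (V ᵀ)) i ⟩
        ((V *ᴹ (U *ᴹ Σ) ᵀ) *ᵛ v) i               ≈⟨ *ᴹ-*ᵛ V ((U *ᴹ Σ) ᵀ) v i ⟩
        (V *ᵛ ((U *ᴹ Σ) ᵀ *ᵛ v)) i               ≈⟨ *ᵛ-congˡ V (*ᵛ-congʳ v (ᵀ-*ᴹ U Σ)) i ⟩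
        (V *ᵛ ((Σ ᵀ *ᴹ U ᵀ) *ᵛ v)) i             ≈⟨ *ᵛ-congˡ V (*ᴹ-*ᵛ (Σ ᵀ) (U ᵀ) v) i ⟩
        (V *ᵛ (Σ ᵀ *ᵛ (U ᵀ *ᵛ v))) i             ∎

      ᵀ-cancel : ∀ {k} {O : Matrix k k} → IsOrthogonal O → ∀ v → O ᵀ *ᵛ (O *ᵛ v) ≈ᵛ v
      ᵀ-cancel {O = O} orth v i = begin
        (O ᵀ *ᵛ (O *ᵛ v)) i                      ≈⟨ *ᴹ-*ᵛ (O ᵀ) O v i ⟨
        ((O ᵀ *ᴹ O) *ᵛ v) i                      ≈⟨ *ᵛ-congʳ v (IsOrthogonal.orthogonalˡ orth) i ⟩
        (1ᴹ *ᵛ v) i                              ≈⟨ 1ᴹ-*ᵛ v i ⟩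
        v i                                      ∎

    -- In Uᵀ (U Σ Vᵀ)(V Σᵀ Uᵀ) both orthogonal pairs cancel, leaving Σ Σᵀ Uᵀ, and Σ Σᵀ is diagonal
    -- with entries σᵢ².
    singularVectors-diagonalise : ∀ {M : Matrix m m} →
      (∀ v → M *ᵛ v ≈ᵛ B *ᵛ (B ᵀ *ᵛ v)) → Diagonalises (U ᵀ) M (λ i → σ i ^ 2)
    singularVectors-diagonalise {M} M≈BBᵀ v i = begin
      (U ᵀ *ᵛ (M *ᵛ v)) i                        ≈⟨ *ᵛ-congˡ (U ᵀ) (M≈BBᵀ v) i ⟩
      (U ᵀ *ᵛ (B *ᵛ (B ᵀ *ᵛ v))) i               ≈⟨ *ᵛ-congˡ (U ᵀ) (B-action (B ᵀ *ᵛ v)) i ⟩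
      (U ᵀ *ᵛ (U *ᵛ (Σ *ᵛ (V ᵀ *ᵛ (B ᵀ *ᵛ v))))) i
                                                 ≈⟨ ᵀ-cancel U-orthogonal (Σ *ᵛ (V ᵀ *ᵛ (B ᵀ *ᵛ v))) i ⟩
      (Σ *ᵛ (V ᵀ *ᵛ (B ᵀ *ᵛ v))) i               ≈⟨ *ᵛ-congˡ Σ (*ᵛ-congˡ (V ᵀ) (Bᵀ-action v)) i ⟩
      (Σ *ᵛ (V ᵀ *ᵛ (V *ᵛ (Σ ᵀ *ᵛ (U ᵀ *ᵛ v))))) i
                                                 ≈⟨ *ᵛ-congˡ Σ (ᵀ-cancel V-orthogonal (Σ ᵀ *ᵛ (U ᵀ *ᵛ v))) i ⟩
      (Σ *ᵛ (Σ ᵀ *ᵛ (U ᵀ *ᵛ v))) i               ≈⟨ rectangularDiagonal-square m≤n σ (U ᵀ *ᵛ v) i ⟩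
      σ i ^ 2 * (U ᵀ *ᵛ v) i                     ∎

  diagonal⇒symmetric : ∀ {D : Matrix n n} → IsDiagonal D → D ᵀ ≈ᴹ D
  diagonal⇒symmetric diag i j with i Fin.≟ j
  ... | yes ≡.refl = refl
  ... | no i≢j     = trans (diag j i (λ j≡i → i≢j (≡.sym j≡i))) (sym (diag i j i≢j))

  -- Symmetry of `R` and `D` gives (R A D)ᵀ = D Aᵀ R. Stated for the action on vectors, the
  -- regrouping of the long product reduces to `*ᴹ-*ᵛ`.
  symmetric-product-action : (R : Matrix m m) (A : Matrix m n) (D : Matrix n n) →
    R ᵀ ≈ᴹ R → D ᵀ ≈ᴹ D → ∀ v →
    (R *ᴹ A *ᴹ (D *ᴹ D) *ᴹ A ᵀ *ᴹ R) *ᵛ v ≈ᵛ (R *ᴹ A *ᴹ D) *ᵛ ((R *ᴹ A *ᴹ D) ᵀ *ᵛ v)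
  symmetric-product-action R A D Rᵀ≈R Dᵀ≈D v i = begin
    ((RA *ᴹ (D *ᴹ D) *ᴹ A ᵀ *ᴹ R) *ᵛ v) i        ≈⟨ *ᴹ-*ᵛ (RA *ᴹ (D *ᴹ D) *ᴹ A ᵀ) R v i ⟩
    ((RA *ᴹ (D *ᴹ D) *ᴹ A ᵀ) *ᵛ (R *ᵛ v)) i      ≈⟨ *ᴹ-*ᵛ (RA *ᴹ (D *ᴹ D)) (A ᵀ) (R *ᵛ v) i ⟩
    ((RA *ᴹ (D *ᴹ D)) *ᵛ w) i                    ≈⟨ *ᴹ-*ᵛ RA (D *ᴹ D) w i ⟩
    (RA *ᵛ ((D *ᴹ D) *ᵛ w)) i                    ≈⟨ *ᵛ-congˡ RA (*ᴹ-*ᵛ D D w) i ⟩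
    (RA *ᵛ (D *ᵛ (D *ᵛ w))) i                    ≈⟨ *ᴹ-*ᵛ RA D (D *ᵛ w) i ⟨
    ((RA *ᴹ D) *ᵛ (D *ᵛ w)) i                    ≈⟨ *ᵛ-congˡ (RA *ᴹ D) transposed i ⟨
    ((RA *ᴹ D) *ᵛ ((RA *ᴹ D) ᵀ *ᵛ v)) i          ∎
    where
    RA = R *ᴹ A
    w = A ᵀ *ᵛ (R *ᵛ v)
    transposed : (RA *ᴹ D) ᵀ *ᵛ v ≈ᵛ D *ᵛ w
    transposed j = begin
      ((RA *ᴹ D) ᵀ *ᵛ v) j                       ≈⟨ *ᵛ-congʳ v (ᵀ-*ᴹ RA D) j ⟩
      ((D ᵀ *ᴹ RA ᵀ) *ᵛ v) j                     ≈⟨ *ᴹ-*ᵛ (D ᵀ) (RA ᵀ) v j ⟩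
      (D ᵀ *ᵛ (RA ᵀ *ᵛ v)) j                     ≈⟨ *ᵛ-congʳ (RA ᵀ *ᵛ v) Dᵀ≈D j ⟩
      (D *ᵛ (RA ᵀ *ᵛ v)) j                       ≈⟨ *ᵛ-congˡ D (*ᵛ-congʳ v (ᵀ-*ᴹ R A)) j ⟩
      (D *ᵛ ((A ᵀ *ᴹ R ᵀ) *ᵛ v)) j               ≈⟨ *ᵛ-congˡ D (*ᴹ-*ᵛ (A ᵀ) (R ᵀ) v) j ⟩
      (D *ᵛ (A ᵀ *ᵛ (R ᵀ *ᵛ v))) j               ≈⟨ *ᵛ-congˡ D (*ᵛ-congˡ (A ᵀ) (*ᵛ-congʳ v Rᵀ≈R)) j ⟩
      (D *ᵛ w) j                                 ∎

  last-≤ : .{{_ : NonZero m}} (σ : ℝ^ m) → (∀ i j → i Fin.≤ j → σ j ≤ σ i) → ∀ i → last σ ≤ σ i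
  last-≤ {m = suc m} σ descending i = descending i (Fin.fromℕ m) (Fin.≤fromℕ i)

  last-nonneg : .{{_ : NonZero m}} (σ : ℝ^ m) → (∀ i → 0# ≤ σ i) → 0# ≤ last σ
  last-nonneg {m = suc m} σ nonneg = nonneg (Fin.fromℕ m)

  ≤-first : .{{_ : NonZero m}} (σ : ℝ^ m) → (∀ i j → i Fin.≤ j → σ j ≤ σ i) → ∀ i → σ i ≤ first σ
  ≤-first {m = suc m} σ descending i = descending Fin.zero i ℕ.z≤n

mainTheorem3 :
  ∀ {c ℓ₁ ℓ₂} (ℝ : RealNumbers c ℓ₁ ℓ₂) →
  let open RealNumbers ℝ
      open OrderLemmas ℝ
      open LinearAlgebra ℝ
      open ChebyshevIteration ℝ
  in
  {m n : ℕ} .{{_ : NonZero m}} (m≤n : m ≤ℕ n) →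
  (A : Matrix m n) → HasRank A m →
  (D : Matrix n n) → IsDiagonal D → (∀ j → 0# < D j j) →
  (p : ℝ^ m) →
  (ζ : Carrier) (0≤ζ : 0# ≤ ζ) (ζ≤1 : ζ ≤ 1#) →
  (Q : Matrix m m) → IsSymmetricPositiveDefinite Q →
  (Q^-½ : Matrix m m) → IsInverseSquareRoot Q^-½ Q →
  let a = 2# / (2# + ζ) ⟨ 0<2+ 0≤ζ ⟩
      b = 2# / (2# - ζ) ⟨ 0<2- ζ≤1 ⟩
      M = Q^-½ *ᴹ A *ᴹ (D *ᴹ D) *ᴹ A ᵀ *ᴹ Q^-½
      q = Q^-½ *ᵛ p
  in
  (σ : ℝ^ m) → AreSingularValues m≤n (Q^-½ *ᴹ A *ᴹ D) σ →
  a ≤ last σ ^ 2 → last σ ^ 2 ≤ first σ ^ 2 → first σ ^ 2 ≤ b →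
  (z : ℕ → ℝ^ m) → AreChebyshevIterates (/-pos 0<2 (0<2+ 0≤ζ)) b M q z →
  (t : ℕ) → ∥ M *ᵛ z t -ᵛ q ∥₂ ≤ ζ ^ t * ∥ q ∥₂
mainTheorem3 ℝ m≤n A _ D D-diagonal _ p ζ 0≤ζ ζ≤1 Q _ Q^-½ Q^-½-root σ sv a≤σₘ² _ σ₁²≤b z iterates t ζ^t∥q∥<∥r∥ =
  -- The last argument `ζ^t∥q∥<∥r∥` is the strict inequality to be refuted, so each sign of `ζ` only
  -- has to yield a contradiction.
  trichotomy-stable 0# ζ λ where
    (inj₁ 0<ζ) →
      let a<b = 0<ζ⇒a<b a[2+ζ]≈2 b[2-ζ]≈2 0<a (/-pos 0<2 (0<2- ζ≤1)) 0<ζ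
      in ∥∥₂-diagonalised-≤ U-orthogonal (P-diagonalised a<b) (^-nonneg 0≤ζ t)
           (λ i → residualFactor-bound 0<a a<b 0≤ζ ζ≤1 (ζθ≈2 a[2+ζ]≈2 b[2-ζ]≈2 0<a a<b) t
             (a≤σ² i) (σ²≤b i))
           (residual a<b t) ζ^t∥q∥<∥r∥
    (inj₂ (inj₁ 0≈ζ)) →
      let a≈b = ζ≈0⇒a≈b a[2+ζ]≈2 b[2-ζ]≈2 (sym 0≈ζ)
      in ∥∥₂-diagonalised-≤ U-orthogonal degenerateP-diagonalised (^-nonneg 0≤ζ t)
           (λ i → ≈⇒≤ (*-cong (factor≈ζ^t a≈b 0≈ζ i) (factor≈ζ^t a≈b 0≈ζ i)))
           (degenerateResidual a≈b t) ζ^t∥q∥<∥r∥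
    (inj₂ (inj₂ ζ<0)) → 0≤ζ ζ<0
  where
  open RealNumbers ℝ
  open OrderLemmas ℝ
  open LinearAlgebra ℝ
  open ChebyshevIteration ℝ
  open OrderedFieldProperties ℝ
  open ChebyshevBounds ℝ
  open LinearAlgebraProperties ℝ
  open Exponentiation (CommutativeRing.semiring commutativeRing) using (^-congˡ)
  open AreSingularValues sv
  open AreChebyshevIterates iterates
  open SetoidReasoning setoid
  a = 2# / (2# + ζ) ⟨ 0<2+ 0≤ζ ⟩
  b = 2# / (2# - ζ) ⟨ 0<2- ζ≤1 ⟩
  0<a = /-pos 0<2 (0<2+ 0≤ζ)
  a[2+ζ]≈2 = /-cancel {2#} (0<2+ 0≤ζ)
  b[2-ζ]≈2 = /-cancel {2#} (0<2- ζ≤1)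
  M = Q^-½ *ᴹ A *ᴹ (D *ᴹ D) *ᴹ A ᵀ *ᴹ Q^-½

  a≤σ² : ∀ i → a ≤ σ i ^ 2
  a≤σ² i = ≤-trans a≤σₘ² (^-mono-≤ (last-nonneg σ nonneg) (last-≤ σ descending i) 2)

  σ²≤b : ∀ i → σ i ^ 2 ≤ b
  σ²≤b i = ≤-trans (^-mono-≤ (nonneg i) (≤-first σ descending i) 2) σ₁²≤b

  M-diagonalised : Diagonalises (U ᵀ) M (λ i → σ i ^ 2)
  M-diagonalised = singularVectors-diagonalise sv
    (symmetric-product-action Q^-½ A D symmetric (diagonal⇒symmetric D-diagonal))
    where open IsSymmetricPositiveDefinite (IsInverseSquareRoot.isSymmetricPositiveDefinite Q^-½-root)

  P-diagonalised : (a<b : a < b) → Diagonalises (U ᵀ) (P 0<a a<b t M)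
    (λ i → residualFactor 0<a a<b t (σ i ^ 2))
  P-diagonalised a<b = diagonalises-·ᴹ _ (diagonalises-T (diagonalises-·ᴹ _ (diagonalises-+ᴹ
    (diagonalises-·ᴹ _ diagonalises-1ᴹ) (diagonalises--ᴹ (diagonalises-·ᴹ _ M-diagonalised)))) t)

  factor : Carrier → Carrier
  factor x = 1# - (1# / a ⟨ 0<a ⟩) * x

  degenerateP-diagonalised : Diagonalises (U ᵀ) (degenerateP 0<a t M) (λ i → factor (σ i ^ 2) ^ t)
  degenerateP-diagonalised = diagonalises-^ᴹ (diagonalises-+ᴹ diagonalises-1ᴹ
    (diagonalises--ᴹ (diagonalises-·ᴹ _ M-diagonalised))) t

  -- When `a ≈ b`, every σᵢ² is squeezed to `a`, so the base `factor (σ i ^ 2)` is zero, like `ζ`.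
  -- Comparing bases instead of powers also covers `t = 0`, where both powers are `1#`.
  factor≈ζ^t : a ≈ b → 0# ≈ ζ → ∀ i → factor (σ i ^ 2) ^ t ≈ ζ ^ t
  factor≈ζ^t a≈b 0≈ζ i = ^-congˡ t (begin
    1# - (1# / a ⟨ 0<a ⟩) * σ i ^ 2   ≈⟨ +-congˡ (-‿cong (*-congˡ
                                         (≤-antisym (≤-respʳ-≈ (sym a≈b) (σ²≤b i)) (a≤σ² i)))) ⟩
    1# - (1# / a ⟨ 0<a ⟩) * a         ≈⟨ +-congˡ (-‿cong (/-cancel 0<a)) ⟩
    1# - 1#                           ≈⟨ -‿inverseʳ 1# ⟩
    0#                                ≈⟨ 0≈ζ ⟩
    ζ                                 ∎)
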